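{- For all $n\geq 1$, $s_{n,2}(112,122)=c_n=\frac{1}{n+1}\binom{2n}{n}$, the $n$-th Catalan number.
   Context: For positive integers $n,m$, $[n]_m$ denotes the regular multiset $\{1^m,\ldots,n^m\}$, and a permutation of $[n]_m$ is a sequence of length $nm$ in which each $i\in[n]$ appears exactly $m$ times. A sequence $\sigma$ contains a pattern $\pi=\pi_1\cdots\pi_k$ if it has a subsequence $\sigma_{i_1}\cdots\sigma_{i_k}$ ($i_1<\dots<i_k$) order-isomorphic to $\pi$, i.e. $\sigma_{i_a}<\sigma_{i_b}\iff\pi_a<\pi_b$ and $\sigma_{i_a}=\sigma_{i_b}\iff\pi_a=\pi_b$; otherwise it avoids $\pi$. $s_{n,m}(\Pi)$ is the number of permutations of $[n]_m$ avoiding all patterns in $\Pi$. -}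

module Defs where

open import Data.Fin.Base as Fin using (Fin)
import Data.Fin.Properties as Fin
open import Data.List.Base as List using (List; []; _∷_; length; filter; allFin; cartesianProductWith)
open import Data.List.Membership.Propositional using (_∈_; find; lose)
open import Data.List.Membership.Propositional.Properties using (∈-cartesianProductWith⁺; ∈-allFin)
open import Data.List.Relation.Unary.All as All using (All; all?)
open import Data.List.Relation.Unary.Any as Any using (here)
open import Data.List.Relation.Unary.AllPairs using ([]; _∷_)
open import Data.List.Relation.Unary.Unique.Propositional using (Unique)
open import Data.List.Relation.Unary.Unique.Propositional.Properties using (cartesianProductWith⁺; allFin⁺)
open import Data.Nat.Base using (ℕ; zero; suc; _+_; _*_; _<_)
open import Data.Nat.Combinatorics using (_C_; nC1≡n; nCk+nC[k+1]≡[n+1]C[k+1])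
open import Data.Nat.Coprimality using (Coprime; coprime-divisor)
open import Data.Nat.Divisibility using (_∣_; divides; ∣1⇒≡1; ∣m+n∣m⇒∣n; ∣n⇒∣m*n)
open import Data.Nat.DivMod using (_/_; m*[n/m]≡n)
open import Data.Nat.Properties using (_≟_; _<?_; *-comm; *-zeroʳ)
open import Data.Nat.Solver using (module +-*-Solver)
open import Data.Product.Base using (_×_; _,_; ∃)
open import Data.Vec.Base as Vec using (Vec; []; _∷_; lookup; count)
open import Data.Vec.Properties using (∷-injective)
open import Function.Bundles using (_⇔_; mk⇔; Equivalence)
open import Relation.Binary.Core using (_Preserves_⟶_)
open import Relation.Binary.PropositionalEquality
  using (_≡_; refl; sym; cong; cong₂; subst; module ≡-Reasoning)
open import Relation.Nullary.Decidable using (Dec; map′; ¬?; _×-dec_; _→-dec_)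
open import Relation.Nullary.Negation using (¬_)
open import Relation.Unary using (Decidable)

private
  variable
    n m l : ℕ

-- The alphabet [n] = {1 < ⋯ < n} is represented by Fin n, shifted down by one.

Word : ℕ → ℕ → Set
Word n l = Vec (Fin n) l

IsPermutation : ∀ n m → Word n (n * m) → Set
IsPermutation n m σ = ∀ (i : Fin n) → count (i Fin.≟_) σ ≡ m

-- Only the relative order and the equalities of the letters of a pattern matter.

Pattern : Set
Pattern = List ℕ

-- is holds the positions i₁ , … , iₖ of an occurrence of π in σ.

record Occurrence (σ : Word n l) (π : Pattern) (is : Vec (Fin l) (length π)) : Set where
  constructor mkOccurrence
  field
    increasing : lookup is Preserves Fin._<_ ⟶ Fin._<_
    <-iso      : ∀ a b → (lookup σ (lookup is a) Fin.< lookup σ (lookup is b))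
                         ⇔ (List.lookup π a < List.lookup π b)
    ≡-iso      : ∀ a b → (lookup σ (lookup is a) ≡ lookup σ (lookup is b))
                         ⇔ (List.lookup π a ≡ List.lookup π b)

Contains : Word n l → Pattern → Set
Contains σ π = ∃ (Occurrence σ π)

Avoids : Word n l → Pattern → Set
Avoids σ π = ¬ Contains σ π

words : ∀ n l → List (Word n l)
words n zero    = [] ∷ []
words n (suc l) = cartesianProductWith _∷_ (allFin n) (words n l)

∈-words : (σ : Word n l) → σ ∈ words n l
∈-words []      = here refl
∈-words (i ∷ σ) = ∈-cartesianProductWith⁺ _∷_ (∈-allFin i) (∈-words σ)

words-unique : ∀ n l → Unique (words n l)
words-unique n zero    = All.[] ∷ []
words-unique n (suc l) = cartesianProductWith⁺ _∷_ ∷-injective (allFin⁺ n) (words-unique n l)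

private
  ⇔-dec : {A B : Set} → Dec A → Dec B → Dec (A ⇔ B)
  ⇔-dec a? b? = map′ (λ (f , g) → mk⇔ f g) (λ e → Equivalence.to e , Equivalence.from e)
    ((a? →-dec b?) ×-dec (b? →-dec a?))

isPermutation? : ∀ n m → Decidable (IsPermutation n m)
isPermutation? n m σ = Fin.all? (λ i → count (i Fin.≟_) σ ≟ m)

occurrence? : (σ : Word n l) (π : Pattern) → Decidable (Occurrence σ π)
occurrence? σ π is = map′
  (λ (inc , lt , eq) → mkOccurrence (λ {a} {b} → inc a b) lt eq)
  (λ o → let open Occurrence o in (λ a b → increasing {a} {b}) , <-iso , ≡-iso)
  (Fin.all? (λ a → Fin.all? (λ b → (a Fin.<? b) →-dec (lookup is a Fin.<? lookup is b)))
   ×-dec Fin.all? (λ a → Fin.all? (λ b →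
     ⇔-dec (lookup σ (lookup is a) Fin.<? lookup σ (lookup is b))
           (List.lookup π a <? List.lookup π b)))
   ×-dec Fin.all? (λ a → Fin.all? (λ b →
     ⇔-dec (lookup σ (lookup is a) Fin.≟ lookup σ (lookup is b))
           (List.lookup π a ≟ List.lookup π b))))

contains? : (σ : Word n l) → Decidable (Contains σ)
contains? {l = l} σ π = map′
  (λ any → let is , _ , o = find any in is , o)
  (λ (is , o) → lose (∈-words is) o)
  (Any.any? (occurrence? σ π) (words l (length π)))

avoids? : (σ : Word n l) → Decidable (Avoids σ)
avoids? σ π = ¬? (contains? σ π)

s : ℕ → ℕ → List Pattern → ℕ
s n m Π = length (filter (λ σ → isPermutation? n m σ ×-dec all? (avoids? σ) Π) (words n (n * m)))

-- The division is exact, see catalan-exact.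

catalan : ℕ → ℕ
catalan n = ((2 * n) C n) / suc n

private
  absorption : ∀ n k → suc k * (suc n C suc k) ≡ suc n * (n C k)
  absorption zero    zero    = refl
  absorption zero    (suc k) = *-zeroʳ k
  absorption (suc n) zero    = begin
    1 * (suc (suc n) C 1)     ≡⟨ cong (1 *_) (nC1≡n (suc (suc n))) ⟩
    1 * suc (suc n)           ≡⟨ *-comm 1 (suc (suc n)) ⟩
    suc (suc n) * (suc n C 0) ∎
    where open ≡-Reasoning
  absorption (suc n) (suc k) = begin
    suc (suc k) * (suc (suc n) C suc (suc k))
      ≡⟨ cong (suc (suc k) *_) (nCk+nC[k+1]≡[n+1]C[k+1] (suc n) (suc k)) ⟨
    suc (suc k) * (x + y)
      ≡⟨ solve 3 (λ k x y → (con 2 :+ k) :* (x :+ y)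
                          := x :+ ((con 1 :+ k) :* x :+ (con 2 :+ k) :* y)) refl k x y ⟩
    x + (suc k * x + suc (suc k) * y)
      ≡⟨ cong (x +_) (cong₂ _+_ (absorption n k) (absorption n (suc k))) ⟩
    x + (suc n * (n C k) + suc n * (n C suc k))
      ≡⟨ solve 4 (λ n x u v → x :+ ((con 1 :+ n) :* u :+ (con 1 :+ n) :* v)
                            := x :+ (con 1 :+ n) :* (u :+ v)) refl n x (n C k) (n C suc k) ⟩
    x + suc n * (n C k + n C suc k)
      ≡⟨ cong (λ z → x + suc n * z) (nCk+nC[k+1]≡[n+1]C[k+1] n k) ⟩
    suc (suc n) * (suc n C suc k) ∎
    where
    open ≡-Reasoning
    open +-*-Solver
    x = suc n C suc k
    y = suc n C suc (suc k)

  coprime : ∀ n → Coprime (suc n) (suc (2 * n))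
  coprime n {d} (d∣1+n , d∣1+2n) = ∣1⇒≡1 (∣m+n∣m⇒∣n (subst (d ∣_) eq (∣n⇒∣m*n 2 d∣1+n)) d∣1+2n)
    where
    open +-*-Solver
    eq : 2 * suc n ≡ suc (2 * n) + 1
    eq = solve 1 (λ n → con 2 :* (con 1 :+ n) := con 1 :+ con 2 :* n :+ con 1) refl n

catalan-exact : ∀ n → suc n * catalan n ≡ (2 * n) C n
catalan-exact n = m*[n/m]≡n (coprime-divisor (coprime n)
  (divides (suc (2 * n) C suc n) (begin
    suc (2 * n) * ((2 * n) C n)     ≡⟨ absorption (2 * n) n ⟨
    suc n * (suc (2 * n) C suc n)   ≡⟨ *-comm (suc n) _ ⟩
    (suc (2 * n) C suc n) * suc n   ∎)))
  where open ≡-Reasoning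

{-# OPTIONS --safe #-}

-- For letters a < b, avoiding 112 and 122 leaves only bbaa and baba as the subword on a and b.
-- Hence the first occurrences of the letters come in decreasing order, and so do the second
-- occurrences, so the permutation is determined by the Dyck path which has an up step at every
-- first and a down step at every second occurrence, and every Dyck path arises.  Dyck paths are
-- counted by the ballot numbers.

module Submission where

open import Defs
open import Data.Bool.Base using (Bool; true; false; if_then_else_; T)
open import Data.Fin.Base as Fin using (Fin; zero; suc; toℕ; fromℕ<)
import Data.Fin.Properties as Fin
open import Data.List.Base as List
  using (List; []; _∷_; _++_; length; map; filter; drop; replicate)
open import Data.List.Properties using (length-map; length-++; ∷-injective; ∷-injectiveˡ; ∷-injectiveʳ)
open import Data.List.Membership.Propositional using (_∈_)
open import Data.List.Membership.Propositional.Properties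
  using (∈-map⁺; ∈-map⁻; ∈-++⁺ˡ; ∈-++⁺ʳ; ∈-++⁻; ∈-filter⁺; ∈-filter⁻; ∈-lookup)
open import Data.List.Membership.Propositional.Properties.WithK using (unique∧set⇒bag)
open import Data.List.Relation.Binary.BagAndSetEquality using (∼bag⇒↭)
open import Data.List.Relation.Binary.Permutation.Propositional.Properties using (↭-length)
open import Data.List.Relation.Binary.Sublist.Propositional
  using (_⊆_; []; _∷_; _∷ʳ_; minimum; ⊆-refl; ⊆-trans)
open import Data.List.Relation.Binary.Sublist.Propositional.Properties using (∷ʳ⁻; drop⁺-≥)
open import Data.List.Relation.Unary.All as All using (All; []; _∷_; all?)
open import Data.List.Relation.Unary.Any using (here)
open import Data.List.Relation.Unary.AllPairs using ([]; _∷_)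
open import Data.List.Relation.Unary.Unique.Propositional using (Unique)
import Data.List.Relation.Unary.Unique.Propositional.Properties as Unique
open import Data.Nat.Base
open import Data.Nat.Combinatorics using (_C_; k>n⇒nCk≡0; nCk≡nC[n∸k]; nC1≡n; nCk+nC[k+1]≡[n+1]C[k+1])
open import Data.Nat.Properties
open import Data.Nat.Solver using (module +-*-Solver)
open import Data.Product.Base using (_×_; _,_; ∃; proj₁; proj₂)
open import Data.Sum.Base using (_⊎_; inj₁; inj₂)
open import Data.Vec.Base as Vec using (Vec; []; _∷_; lookup; count; toList)
open import Data.Vec.Properties using (lookup-map)
open import Function.Bundles using (_⇔_; mk⇔; Equivalence)
open import Relation.Binary.Core using (_Preserves_⟶_)
open import Relation.Binary.PropositionalEquality
  using (_≡_; refl; sym; trans; cong; cong₂; subst; module ≡-Reasoning)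
open import Relation.Nullary.Decidable using (yes; no; map′; _×-dec_)
import Relation.Nullary.Decidable as Dec
open import Relation.Nullary.Negation using (¬_; contradiction)

private
  variable
    n l p d a b k x : ℕ
    w : List ℕ

-- Multiplicities

𝟙 : Bool → ℕ
𝟙 b = if b then 1 else 0

𝟙-<ᵇ-suc : ∀ x p → 𝟙 (x <ᵇ suc p) ≡ 𝟙 (x ≡ᵇ p) + 𝟙 (x <ᵇ p)
𝟙-<ᵇ-suc zero    zero    = refl
𝟙-<ᵇ-suc zero    (suc p) = refl
𝟙-<ᵇ-suc (suc x) zero    = refl
𝟙-<ᵇ-suc (suc x) (suc p) = 𝟙-<ᵇ-suc x p

𝟙-< : x < p → 𝟙 (x <ᵇ p) ≡ 1
𝟙-< {zero}  (s≤s _)   = refl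
𝟙-< {suc x} (s≤s x<p) = 𝟙-< x<p

𝟙-≥ : p ≤ x → 𝟙 (x <ᵇ p) ≡ 0
𝟙-≥ z≤n       = refl
𝟙-≥ (s≤s p≤x) = 𝟙-≥ p≤x

𝟙-refl : ∀ x → 𝟙 (x ≡ᵇ x) ≡ 1
𝟙-refl zero    = refl
𝟙-refl (suc x) = 𝟙-refl x

multiplicity : ℕ → List ℕ → ℕ
multiplicity x []      = 0
multiplicity x (y ∷ w) = 𝟙 (x ≡ᵇ y) + multiplicity x w

-- With its converse below, this lets the copies of a letter that remain supply the tail of a
-- forbidden sublist, and lets a forbidden sublist contradict a multiplicity.
replicate⊆⇒≤ : ∀ k → replicate k x ⊆ w → k ≤ multiplicity x w
replicate⊆⇒≤ zero    _          = z≤n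
replicate⊆⇒≤ (suc k) (y ∷ʳ s)   = ≤-trans (replicate⊆⇒≤ (suc k) s) (m≤n+m _ _)
replicate⊆⇒≤ {x = x} {w = _ ∷ w} (suc k) (refl ∷ s) =
  subst (λ m → suc k ≤ m + multiplicity x w) (sym (𝟙-refl x)) (s≤s (replicate⊆⇒≤ k s))

≤⇒replicate⊆ : ∀ k w → k ≤ multiplicity x w → replicate k x ⊆ w
≤⇒replicate⊆         zero    w       _ = minimum w
≤⇒replicate⊆ {x = x} (suc k) (y ∷ w) k≤ with x ≡ᵇ y in eq
... | true  = ≡ᵇ⇒≡ x y (subst T (sym eq) _) ∷ ≤⇒replicate⊆ k w (s≤s⁻¹ k≤)
... | false = y ∷ʳ ≤⇒replicate⊆ (suc k) w k≤

-- Dyck paths as words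

-- A state (p , d) has p letters still to be opened (the letters below p) and d open ones to be
-- closed (the letters from p up to p + d), that is, d is the height of the path.

data Ballot : ℕ → ℕ → List ℕ → Set where
  done  : Ballot 0 0 []
  -- Both kinds of step take the largest letter available, so the letters are closed in the order in
  -- which they were opened.
  open′ : Ballot p (suc d) w → Ballot (suc p) d (p ∷ w)
  close : Ballot p d w → Ballot p (suc d) (p + d ∷ w)

ballots : ℕ → ℕ → List (List ℕ)
ballots zero    zero    = [] ∷ []
ballots zero    (suc d) = map (d ∷_) (ballots zero d)
ballots (suc p) zero    = map (p ∷_) (ballots p 1)
ballots (suc p) (suc d) = map (p ∷_) (ballots p (2 + d)) ++ map (suc p + d ∷_) (ballots (suc p) d)

∈-ballots⁺ : Ballot p d w → w ∈ ballots p d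
∈-ballots⁺                 done      = here refl
∈-ballots⁺ {suc p} {zero}  (open′ v) = ∈-map⁺ (p ∷_) (∈-ballots⁺ v)
∈-ballots⁺ {suc p} {suc d} (open′ v) = ∈-++⁺ˡ (∈-map⁺ (p ∷_) (∈-ballots⁺ v))
∈-ballots⁺ {zero}  {suc d} (close v) = ∈-map⁺ (d ∷_) (∈-ballots⁺ v)
∈-ballots⁺ {suc p} {suc d} (close v) =
  ∈-++⁺ʳ (map (p ∷_) (ballots p (2 + d))) (∈-map⁺ (suc p + d ∷_) (∈-ballots⁺ v))

∈-ballots⁻ : ∀ p d → w ∈ ballots p d → Ballot p d w
∈-ballots⁻ zero    zero    (here refl) = done
∈-ballots⁻ zero    (suc d) w∈ with _ , v , refl ← ∈-map⁻ (d ∷_) w∈ = close (∈-ballots⁻ zero d v)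
∈-ballots⁻ (suc p) zero    w∈ with _ , v , refl ← ∈-map⁻ (p ∷_) w∈ = open′ (∈-ballots⁻ p 1 v)
∈-ballots⁻ (suc p) (suc d) w∈ with ∈-++⁻ (map (p ∷_) (ballots p (2 + d))) w∈
... | inj₁ w∈₁ with _ , v , refl ← ∈-map⁻ (p ∷_) w∈₁ = open′ (∈-ballots⁻ p (2 + d) v)
... | inj₂ w∈₂ with _ , v , refl ← ∈-map⁻ (suc p + d ∷_) w∈₂ = close (∈-ballots⁻ (suc p) d v)

ballots-unique : ∀ p d → Unique (ballots p d)
ballots-unique zero    zero    = [] ∷ []
ballots-unique zero    (suc d) = Unique.map⁺ ∷-injectiveʳ (ballots-unique zero d)
ballots-unique (suc p) zero    = Unique.map⁺ ∷-injectiveʳ (ballots-unique p 1)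
ballots-unique (suc p) (suc d) = Unique.++⁺
  (Unique.map⁺ ∷-injectiveʳ (ballots-unique p (2 + d)))
  (Unique.map⁺ ∷-injectiveʳ (ballots-unique (suc p) d))
  -- The two branches are disjoint: an opening writes `p` first, a closing the strictly larger
  -- `suc p + d`.
  λ (∈₁ , ∈₂) → let _ , _ , eq₁ = ∈-map⁻ (p ∷_) ∈₁
                    _ , _ , eq₂ = ∈-map⁻ (suc p + d ∷_) ∈₂
                in m≢1+m+n p (∷-injectiveˡ (trans (sym eq₁) eq₂))

ballot-length : Ballot p d w → length w ≡ p + (p + d)
ballot-length done = refl
ballot-length (open′ {p} {d} v) = cong suc (trans (ballot-length v) (cong (p +_) (+-suc p d)))
ballot-length (close {p} {d} v) =
  trans (cong suc (ballot-length v)) (trans (sym (+-suc p (p + d))) (cong (p +_) (sym (+-suc p d))))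

ballot-bounded : Ballot p d w → All (_< p + d) w
ballot-bounded done = []
ballot-bounded (open′ {p} {d} {w} v) =
  s≤s (m≤m+n p d) ∷ subst (λ m → All (_< m) w) (+-suc p d) (ballot-bounded v)
ballot-bounded (close {p} {d} v) =
  p+d< ∷ All.map (λ x< → <-trans x< p+d<) (ballot-bounded v)
  where p+d< = +-monoʳ-< p (n<1+n d)

-- Pattern avoidance characterises the Dyck paths

-- The number of copies of `x` still to be read in state `(p , d)`: two if `x` is unopened, one if
-- it is open, none if it is closed. Written as a sum of two indicators, it changes in just one of
-- them at each step of the path.
profile : ℕ → ℕ → ℕ → ℕ
profile p d x = 𝟙 (x <ᵇ p) + 𝟙 (x <ᵇ p + d)

-- Opening a letter keeps the bound of the second indicator, since `suc p + d` equals `p + suc d`;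
-- closing one keeps the first.
profile-open : ∀ p d x → profile (suc p) d x ≡ 𝟙 (x ≡ᵇ p) + profile p (suc d) x
profile-open p d x = begin
  𝟙 (x <ᵇ suc p) + 𝟙 (x <ᵇ suc (p + d))          ≡⟨ cong₂ _+_ (𝟙-<ᵇ-suc x p)
                                                      (cong (λ m → 𝟙 (x <ᵇ m)) (sym (+-suc p d))) ⟩
  𝟙 (x ≡ᵇ p) + 𝟙 (x <ᵇ p) + 𝟙 (x <ᵇ p + suc d)   ≡⟨ +-assoc (𝟙 (x ≡ᵇ p)) _ _ ⟩
  𝟙 (x ≡ᵇ p) + profile p (suc d) x               ∎
  where open ≡-Reasoning

profile-close : ∀ p d x → profile p (suc d) x ≡ 𝟙 (x ≡ᵇ p + d) + profile p d x
profile-close p d x = begin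
  u + 𝟙 (x <ᵇ p + suc d)       ≡⟨ cong (λ m → u + 𝟙 (x <ᵇ m)) (+-suc p d) ⟩
  u + 𝟙 (x <ᵇ suc (p + d))     ≡⟨ cong (u +_) (𝟙-<ᵇ-suc x (p + d)) ⟩
  u + (e + 𝟙 (x <ᵇ p + d))     ≡⟨ solve 3 (λ u e v → u :+ (e :+ v) := e :+ (u :+ v)) refl u e _ ⟩
  e + profile p d x            ∎
  where
  open ≡-Reasoning
  open +-*-Solver
  u = 𝟙 (x <ᵇ p)
  e = 𝟙 (x ≡ᵇ p + d)

profile-unopened : ∀ d → x < p → profile p d x ≡ 2
profile-unopened d x<p = cong₂ _+_ (𝟙-< x<p) (𝟙-< (m≤n⇒m≤n+o d x<p))

profile-unclosed : ∀ p d → x < p + d → 1 ≤ profile p d x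
profile-unclosed p d x<p+d = ≤-trans (≤-reflexive (sym (𝟙-< x<p+d))) (m≤n+m _ _)

profile-opened : ∀ p d → p ≤ x → profile p d x ≤ 1
profile-opened {x} p d p≤x rewrite 𝟙-≥ p≤x with x <ᵇ p + d
... | true  = s≤s z≤n
... | false = z≤n

profile-closed : ∀ p d → p + d ≤ x → profile p d x ≡ 0
profile-closed p d p+d≤x = cong₂ _+_ (𝟙-≥ (m+n≤o⇒m≤o p p+d≤x)) (𝟙-≥ p+d≤x)

-- The last condition accounts for an occurrence of aab whose first letter has been read already.

record Admissible (p d : ℕ) (w : List ℕ) : Set where
  constructor mkAdmissible
  field
    multiplicities : ∀ x → multiplicity x w ≡ profile p d x
    no-aab         : a < b → ¬ (a ∷ a ∷ b ∷ [] ⊆ w)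
    no-abb         : a < b → ¬ (a ∷ b ∷ b ∷ [] ⊆ w)
    no-ab          : p ≤ a → a < b → ¬ (a ∷ b ∷ [] ⊆ w)

open Admissible

admissible-open⁻ : Admissible (suc p) d (p ∷ w) → Admissible p (suc d) w
admissible-open⁻ {p} {d} {w} A = mkAdmissible
  (λ x → +-cancelˡ-≡ (𝟙 (x ≡ᵇ p)) _ _ (trans (multiplicities A x) (profile-open p d x)))
  (λ a<b s → no-aab A a<b (p ∷ʳ s))
  (λ a<b s → no-abb A a<b (p ∷ʳ s))
  no-ab′
  where
  no-ab′ : p ≤ a → a < b → ¬ (a ∷ b ∷ [] ⊆ w)
  no-ab′ p≤a a<b s with m≤n⇒m<n∨m≡n p≤a
  ... | inj₁ p<a  = no-ab A p<a a<b (p ∷ʳ s)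
  -- Here `a` is the letter `p` just opened, which completes `a b` in the rest to an occurrence of
  -- aab.
  ... | inj₂ refl = no-aab A a<b (refl ∷ s)

admissible-close⁻ : Admissible p (suc d) (p + d ∷ w) → Admissible p d w
admissible-close⁻ {p} {d} A = mkAdmissible
  (λ x → +-cancelˡ-≡ (𝟙 (x ≡ᵇ p + d)) _ _ (trans (multiplicities A x) (profile-close p d x)))
  (λ a<b s → no-aab A a<b (_ ∷ʳ s))
  (λ a<b s → no-abb A a<b (_ ∷ʳ s))
  (λ p≤a a<b s → no-ab A p≤a a<b (_ ∷ʳ s))

admissible-head : Admissible p d (x ∷ w) → x < p + d
admissible-head {p} {d} {x} {w} A with x <? p + d
... | yes x<  = x<
... | no  x≮  = contradiction (replicate⊆⇒≤ 1 (refl ∷ minimum w))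
  (subst (λ m → ¬ (1 ≤ m)) (sym (trans (multiplicities A x) (profile-closed p d (≮⇒≥ x≮)))) λ ())

-- A head below `p` would be followed by both copies of the unopened letter `p`, an occurrence of
-- abb.
admissible-head-unopened : Admissible (suc p) d (x ∷ w) → x ≤ p → x ≡ p
admissible-head-unopened {p} {d} {x} {w} A x≤p with m≤n⇒m<n∨m≡n x≤p
... | inj₂ x≡p = x≡p
... | inj₁ x<p = contradiction (refl ∷ ∷ʳ⁻ (>⇒≢ x<p) pp⊆) (no-abb A x<p)
  where
  pp⊆ : p ∷ p ∷ [] ⊆ x ∷ w
  pp⊆ = ≤⇒replicate⊆ 2 (x ∷ w)
    (≤-reflexive (sym (trans (multiplicities A p) (profile-unopened d (n<1+n p)))))

-- A smaller open head would be followed by the outstanding copy of `p + d`, which `no-ab` forbids.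
admissible-head-opened : Admissible p (suc d) (x ∷ w) → p ≤ x → x ≤ p + d → x ≡ p + d
admissible-head-opened {p} {d} {x} {w} A p≤x x≤p+d with m≤n⇒m<n∨m≡n x≤p+d
... | inj₂ x≡p+d = x≡p+d
... | inj₁ x<p+d = contradiction (refl ∷ ∷ʳ⁻ (>⇒≢ x<p+d) q⊆) (no-ab A p≤x x<p+d)
  where
  q⊆ : p + d ∷ [] ⊆ x ∷ w
  q⊆ = ≤⇒replicate⊆ 1 (x ∷ w) (subst (1 ≤_) (sym (multiplicities A (p + d)))
    (profile-unclosed p (suc d) (+-monoʳ-< p (n<1+n d))))

-- Whether the head lies below `p` decides between opening and closing, and the two head lemmas
-- leave a single letter in each case. At height zero a closing is excluded because no copy of a
-- letter from `p` upward remains.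
admissible⇒ballot : ∀ p d w → Admissible p d w → Ballot p d w
admissible⇒ballot zero    zero    []      A = done
admissible⇒ballot zero    (suc d) []      A =
  contradiction (subst (1 ≤_) (sym (multiplicities A d)) (profile-unclosed 0 (suc d) (n<1+n d))) λ ()
admissible⇒ballot (suc p) d       []      A =
  contradiction (trans (multiplicities A p) (profile-unopened d (n<1+n p))) λ ()
admissible⇒ballot p       d       (x ∷ w) A with x <? p
admissible⇒ballot (suc p) d       (x ∷ w) A | yes (s≤s x≤p)
  with refl ← admissible-head-unopened A x≤p = open′ (admissible⇒ballot p (suc d) w (admissible-open⁻ A))
admissible⇒ballot p       zero    (x ∷ w) A | no x≮p =
  contradiction (subst (x <_) (+-identityʳ p) (admissible-head A)) x≮p
admissible⇒ballot p       (suc d) (x ∷ w) A | no x≮p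
  with refl ← admissible-head-opened A (≮⇒≥ x≮p) (s≤s⁻¹ (subst (x <_) (+-suc p d) (admissible-head A)))
  = close (admissible⇒ballot p d w (admissible-close⁻ A))

-- Only occurrences that start at the new letter `p` matter. For aab the rest would contain `p b`,
-- against `no-ab`; for abb it would contain two copies of some `b` above `p`, which has at most one
-- left.
admissible-open⁺ : Admissible p (suc d) w → Admissible (suc p) d (p ∷ w)
admissible-open⁺ {p} {d} {w} A = mkAdmissible
  (λ x → trans (cong (𝟙 (x ≡ᵇ p) +_) (multiplicities A x)) (sym (profile-open p d x)))
  aab abb ab
  where
  aab : a < b → ¬ (a ∷ a ∷ b ∷ [] ⊆ p ∷ w)
  aab a<b (_ ∷ʳ s)   = no-aab A a<b s
  aab a<b (refl ∷ s) = no-ab A ≤-refl a<b s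
  abb : a < b → ¬ (a ∷ b ∷ b ∷ [] ⊆ p ∷ w)
  abb         a<b (_ ∷ʳ s)   = no-abb A a<b s
  abb {b = b} a<b (refl ∷ s) = contradiction (replicate⊆⇒≤ 2 s)
    (≤⇒≯ (subst (_≤ 1) (sym (multiplicities A b)) (profile-opened p (suc d) (<⇒≤ a<b))))
  ab : p < a → a < b → ¬ (a ∷ b ∷ [] ⊆ p ∷ w)
  ab p<a a<b (_ ∷ʳ s)   = no-ab A (<⇒≤ p<a) a<b s
  ab p<a a<b (refl ∷ s) = <-irrefl refl p<a

-- The new letter `p + d` begins no abb or ab because all larger letters are closed; an aab
-- beginning with it would leave an ab that `no-ab` excludes.
admissible-close⁺ : Admissible p d w → Admissible p (suc d) (p + d ∷ w)
admissible-close⁺ {p} {d} {w} A = mkAdmissible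
  (λ x → trans (cong (𝟙 (x ≡ᵇ p + d) +_) (multiplicities A x)) (sym (profile-close p d x)))
  aab abb ab
  where
  absent : p + d < b → ¬ (b ∷ [] ⊆ w)
  absent {b} p+d<b s = contradiction (replicate⊆⇒≤ 1 s)
    (≤⇒≯ (≤-reflexive (trans (multiplicities A b) (profile-closed p d (<⇒≤ p+d<b)))))
  aab : a < b → ¬ (a ∷ a ∷ b ∷ [] ⊆ p + d ∷ w)
  aab a<b (_ ∷ʳ s)   = no-aab A a<b s
  aab a<b (refl ∷ s) = no-ab A (m≤m+n p d) a<b s
  abb : a < b → ¬ (a ∷ b ∷ b ∷ [] ⊆ p + d ∷ w)
  abb a<b (_ ∷ʳ s)   = no-abb A a<b s
  abb a<b (refl ∷ s) = absent a<b (⊆-trans (_ ∷ʳ ⊆-refl) s)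
  ab : p ≤ a → a < b → ¬ (a ∷ b ∷ [] ⊆ p + d ∷ w)
  ab p≤a a<b (_ ∷ʳ s)   = no-ab A p≤a a<b s
  ab p≤a a<b (refl ∷ s) = absent a<b s

ballot⇒admissible : Ballot p d w → Admissible p d w
ballot⇒admissible done      = mkAdmissible (λ x → refl) (λ _ ()) (λ _ ()) (λ _ _ ())
ballot⇒admissible (open′ v) = admissible-open⁺ (ballot⇒admissible v)
ballot⇒admissible (close v) = admissible-close⁺ (ballot⇒admissible v)

-- From words over Fin n to lists of numbers

letters : Word n l → List ℕ
letters σ = map toℕ (toList σ)

letters-injective : {σ τ : Word n l} → letters σ ≡ letters τ → σ ≡ τ
letters-injective {σ = []}    {[]}    _  = refl
letters-injective {σ = i ∷ σ} {j ∷ τ} eq =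
  let i≡j , σ≡τ = ∷-injective eq in cong₂ _∷_ (Fin.toℕ-injective i≡j) (letters-injective σ≡τ)

letters-surjective : All (_< n) w → length w ≡ l → ∃ λ (σ : Word n l) → letters σ ≡ w
letters-surjective []         refl = [] , refl
letters-surjective (x< ∷ w<)  refl =
  let σ , eq = letters-surjective w< refl in fromℕ< x< ∷ σ , cong₂ _∷_ (Fin.toℕ-fromℕ< x<) eq

letters-bounded : (σ : Word n l) → x ∷ w ⊆ letters σ → x < n
letters-bounded (i ∷ σ) (_ ∷ʳ s)   = letters-bounded σ s
letters-bounded (i ∷ σ) (refl ∷ _) = Fin.toℕ<n i

count-letters : ∀ (i : Fin n) (σ : Word n l) → count (i Fin.≟_) σ ≡ multiplicity (toℕ i) (letters σ)
count-letters i []      = refl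
count-letters i (j ∷ σ)
  -- Two decisions of one proposition have the same boolean; for the second decision it is
  -- `toℕ i ≡ᵇ toℕ j`, on which `multiplicity` branches.
  rewrite Dec.does-≡ (i Fin.≟ j) (map′ Fin.toℕ-injective (cong toℕ) (toℕ i ≟ toℕ j))
  with toℕ i ≡ᵇ toℕ j
... | true  = cong suc (count-letters i σ)
... | false = count-letters i σ

-- Pattern occurrences as sublists

assign : ℕ → ℕ → ℕ → ℕ
assign a b 1 = a
assign a b _ = b

-- `assign a b` sends every number except 1 to `b`, so comparisons are transferred only for the
-- pattern letters 1 and 2.
OneOrTwo : ℕ → Set
OneOrTwo k = k ≡ 1 ⊎ k ≡ 2

assign-< : a < b → OneOrTwo x → OneOrTwo k → (assign a b x < assign a b k) ⇔ (x < k)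
assign-< a<b (inj₁ refl) (inj₁ refl) = mk⇔ (λ a<a → contradiction a<a (<-irrefl refl)) λ { (s≤s ()) }
assign-< a<b (inj₁ refl) (inj₂ refl) = mk⇔ (λ _ → s≤s (s≤s z≤n)) (λ _ → a<b)
assign-< a<b (inj₂ refl) (inj₁ refl) = mk⇔ (λ b<a → contradiction b<a (<-asym a<b)) λ { (s≤s ()) }
assign-< a<b (inj₂ refl) (inj₂ refl) = mk⇔ (λ b<b → contradiction b<b (<-irrefl refl)) λ { (s≤s (s≤s ())) }

assign-≡ : a < b → OneOrTwo x → OneOrTwo k → (assign a b x ≡ assign a b k) ⇔ (x ≡ k)
assign-≡ a<b (inj₁ refl) (inj₁ refl) = mk⇔ (λ _ → refl) (λ _ → refl)
assign-≡ a<b (inj₁ refl) (inj₂ refl) = mk⇔ (λ a≡b → contradiction a≡b (<⇒≢ a<b)) λ ()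
assign-≡ a<b (inj₂ refl) (inj₁ refl) = mk⇔ (λ b≡a → contradiction b≡a (>⇒≢ a<b)) λ ()
assign-≡ a<b (inj₂ refl) (inj₂ refl) = mk⇔ (λ _ → refl) (λ _ → refl)

-- Induction on the sublist: a skipped letter shifts all positions by one, a matched letter also
-- puts `zero` in front.
sublist⇒positions : (f : ℕ → ℕ) (π : Pattern) (σ : Word n l) → map f π ⊆ letters σ →
  ∃ λ (is : Vec (Fin l) (length π)) → lookup is Preserves Fin._<_ ⟶ Fin._<_ ×
    (∀ j → toℕ (lookup σ (lookup is j)) ≡ f (List.lookup π j))
sublist⇒positions f []      σ       s          = [] , (λ { {()} }) , λ ()
sublist⇒positions f (x ∷ π) (i ∷ σ) (_ ∷ʳ s) = Vec.map suc is , mono , values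
  where
  rec = sublist⇒positions f (x ∷ π) σ s
  is  = proj₁ rec
  mono : lookup (Vec.map suc is) Preserves Fin._<_ ⟶ Fin._<_
  mono {j} {k} j<k rewrite lookup-map j Fin.suc is | lookup-map k Fin.suc is = s≤s (proj₁ (proj₂ rec) j<k)
  values : ∀ j → toℕ (lookup (i ∷ σ) (lookup (Vec.map suc is) j)) ≡ f (List.lookup (x ∷ π) j)
  values j rewrite lookup-map j Fin.suc is = proj₂ (proj₂ rec) j
sublist⇒positions f (x ∷ π) (i ∷ σ) (eq ∷ s) = zero ∷ Vec.map suc is , mono , values
  where
  rec = sublist⇒positions f π σ s
  is  = proj₁ rec
  mono : lookup (zero ∷ Vec.map suc is) Preserves Fin._<_ ⟶ Fin._<_
  mono {zero}  {suc k} _ rewrite lookup-map k Fin.suc is = s≤s z≤n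
  mono {suc j} {suc k} (s≤s j<k)
    rewrite lookup-map j Fin.suc is | lookup-map k Fin.suc is = s≤s (proj₁ (proj₂ rec) j<k)
  values : ∀ j → toℕ (lookup (i ∷ σ) (lookup (zero ∷ Vec.map suc is) j)) ≡ f (List.lookup (x ∷ π) j)
  values zero    = sym eq
  values (suc j) rewrite lookup-map j Fin.suc is = proj₂ (proj₂ rec) j

sublist⇒contains : ∀ {π} (σ : Word n l) → All OneOrTwo π → a < b →
  map (assign a b) π ⊆ letters σ → Contains σ π
sublist⇒contains {a = a} {b} {π} σ π∈ a<b s = is , mkOccurrence mono lt eq
  where
  rec    = sublist⇒positions (assign a b) π σ s
  is     = proj₁ rec
  values = proj₂ (proj₂ rec)
  mono : lookup is Preserves Fin._<_ ⟶ Fin._<_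
  mono = proj₁ (proj₂ rec)
  oneOrTwo : ∀ j → OneOrTwo (List.lookup π j)
  oneOrTwo j = All.lookup π∈ (∈-lookup j)
  lt : ∀ j k → (lookup σ (lookup is j) Fin.< lookup σ (lookup is k)) ⇔ (List.lookup π j < List.lookup π k)
  lt j k rewrite values j | values k = assign-< a<b (oneOrTwo j) (oneOrTwo k)
  eq : ∀ j k → (lookup σ (lookup is j) ≡ lookup σ (lookup is k)) ⇔ (List.lookup π j ≡ List.lookup π k)
  eq j k = mk⇔
    (λ e → Equivalence.to iso (trans (sym (values j)) (trans (cong toℕ e) (values k))))
    (λ e → Fin.toℕ-injective (trans (values j) (trans (Equivalence.from iso e) (sym (values k)))))
    where iso = assign-≡ a<b (oneOrTwo j) (oneOrTwo k)

drop-letters : ∀ (σ : Word n l) i →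
  drop (toℕ i) (letters σ) ≡ toℕ (lookup σ i) ∷ drop (suc (toℕ i)) (letters σ)
drop-letters (i ∷ σ) zero    = refl
drop-letters (i ∷ σ) (suc j) = drop-letters σ j

-- The free bound `k` lets a subsequence be built from its last letter backwards, with `k` one more
-- than the preceding position, or 0 at the front.
∷-⊆-drop : ∀ (σ : Word n l) i → k ≤ toℕ i → w ⊆ drop (suc (toℕ i)) (letters σ) →
  toℕ (lookup σ i) ∷ w ⊆ drop k (letters σ)
∷-⊆-drop {w = w} σ i k≤i s = ⊆-trans
  (subst (toℕ (lookup σ i) ∷ w ⊆_) (sym (drop-letters σ i)) (refl ∷ s)) (drop⁺-≥ k≤i)

triple-⊆ : ∀ (σ : Word n l) {i j k} → i Fin.< j → j Fin.< k →
  toℕ (lookup σ i) ∷ toℕ (lookup σ j) ∷ toℕ (lookup σ k) ∷ [] ⊆ letters σ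
triple-⊆ σ {i} {j} {k} i<j j<k =
  ∷-⊆-drop σ i z≤n (∷-⊆-drop σ j i<j (∷-⊆-drop σ k j<k (minimum _)))

-- For both patterns the first and third letters give `a < b`, and `≡-iso` replaces the middle
-- letter by the neighbour equal to it.
avoids-112 : (σ : Word n l) → (∀ {a b} → a < b → ¬ (a ∷ a ∷ b ∷ [] ⊆ letters σ)) →
  Avoids σ (1 ∷ 1 ∷ 2 ∷ [])
avoids-112 σ no-aab (i ∷ j ∷ k ∷ [] , o) = no-aab
  (Equivalence.from (<-iso zero (suc (suc zero))) (s≤s (s≤s z≤n)))
  (subst (λ v → _ ∷ toℕ v ∷ _ ⊆ _) (sym (Equivalence.from (≡-iso zero (suc zero)) refl))
    (triple-⊆ σ (increasing {zero} {suc zero} (s≤s z≤n))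
                (increasing {suc zero} {suc (suc zero)} (s≤s (s≤s z≤n)))))
  where open Occurrence o

avoids-122 : (σ : Word n l) → (∀ {a b} → a < b → ¬ (a ∷ b ∷ b ∷ [] ⊆ letters σ)) →
  Avoids σ (1 ∷ 2 ∷ 2 ∷ [])
avoids-122 σ no-abb (i ∷ j ∷ k ∷ [] , o) = no-abb
  (Equivalence.from (<-iso zero (suc (suc zero))) (s≤s (s≤s z≤n)))
  (subst (λ v → _ ∷ toℕ v ∷ _ ⊆ _) (Equivalence.from (≡-iso (suc zero) (suc (suc zero))) refl)
    (triple-⊆ σ (increasing {zero} {suc zero} (s≤s z≤n))
                (increasing {suc zero} {suc (suc zero)} (s≤s (s≤s z≤n)))))
  where open Occurrence o

-- Correspondence between avoiding permutations and Dyck words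

Π : List Pattern
Π = (1 ∷ 1 ∷ 2 ∷ []) ∷ (1 ∷ 2 ∷ 2 ∷ []) ∷ []

Good : ∀ n → Word n (n * 2) → Set
Good n σ = IsPermutation n 2 σ × All (Avoids σ) Π

good⇒admissible : (σ : Word n (n * 2)) → Good n σ → Admissible n 0 (letters σ)
good⇒admissible {n} σ (perm , av₁ ∷ av₂ ∷ []) = mkAdmissible mult
  (λ a<b s → av₁ (sublist⇒contains σ (inj₁ refl ∷ inj₁ refl ∷ inj₂ refl ∷ []) a<b s))
  (λ a<b s → av₂ (sublist⇒contains σ (inj₁ refl ∷ inj₂ refl ∷ inj₂ refl ∷ []) a<b s))
  -- In the initial state nothing has been opened, so this condition only concerns letters `a ≥ n`,
  -- which do not occur.
  (λ n≤a _ s → ≤⇒≯ n≤a (letters-bounded σ s))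
  where
  mult : ∀ x → multiplicity x (letters σ) ≡ profile n 0 x
  mult x with x <? n
  ... | yes x<n = begin
    multiplicity x (letters σ)         ≡⟨ cong (λ y → multiplicity y (letters σ)) (Fin.toℕ-fromℕ< x<n) ⟨
    multiplicity (toℕ i) (letters σ)   ≡⟨ count-letters i σ ⟨
    count (i Fin.≟_) σ                 ≡⟨ perm i ⟩
    2                                  ≡⟨ profile-unopened 0 x<n ⟨
    profile n 0 x                      ∎
    where
    open ≡-Reasoning
    i = fromℕ< x<n
  ... | no x≮n = trans
    (n<1⇒n≡0 (≰⇒> λ 1≤ → x≮n (letters-bounded σ (≤⇒replicate⊆ 1 (letters σ) 1≤))))
    (sym (profile-closed n 0 (subst (_≤ x) (sym (+-identityʳ n)) (≮⇒≥ x≮n))))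

admissible⇒good : (σ : Word n (n * 2)) → Admissible n 0 (letters σ) → Good n σ
admissible⇒good σ A =
  (λ i → trans (count-letters i σ) (trans (multiplicities A (toℕ i)) (profile-unopened 0 (Fin.toℕ<n i))))
  , avoids-112 σ (no-aab A) ∷ avoids-122 σ (no-abb A) ∷ []

-- Two duplicate-free lists with the same members are permutations of each other, hence equally
-- long.
s≡length-ballots : ∀ n → s n 2 Π ≡ length (ballots n 0)
s≡length-ballots n = trans (sym (length-map letters goods))
  (↭-length (∼bag⇒↭ (unique∧set⇒bag
    (Unique.map⁺ letters-injective (Unique.filter⁺ good? (words-unique n (n * 2))))
    (ballots-unique n 0)
    (mk⇔ to from))))
  where
  good? = λ (σ : Word n (n * 2)) → isPermutation? n 2 σ ×-dec all? (avoids? σ) Π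
  goods = filter good? (words n (n * 2))
  to : w ∈ map letters goods → w ∈ ballots n 0
  to w∈ =
    let σ , σ∈ , w≡ = ∈-map⁻ letters w∈
        _ , good    = ∈-filter⁻ good? {xs = words n (n * 2)} σ∈
    in subst (_∈ ballots n 0) (sym w≡) (∈-ballots⁺ (admissible⇒ballot n 0 _ (good⇒admissible σ good)))
  from : w ∈ ballots n 0 → w ∈ map letters goods
  from {w} w∈ =
    let v      = ∈-ballots⁻ n 0 w∈
        σ , eq = letters-surjective (subst (λ m → All (_< m) w) (+-identityʳ n) (ballot-bounded v))
                                    -- The length `n + (n + 0)` is `2 * n` by computation.
                                    (trans (ballot-length v) (*-comm 2 n))
        good   = admissible⇒good σ (subst (Admissible n 0) (sym eq) (ballot⇒admissible v))
    in subst (_∈ map letters goods) eq (∈-map⁺ letters (∈-filter⁺ good? (∈-words σ) good))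

-- Ballot numbers

-- The sum of the two hypotheses, with Pascal's rule on either side. In `length-ballots`, `x` and
-- `y` count the words that start with an opening and with a closing, and are 0 where that start is
-- impossible.
pascal-step : ∀ N k {x y} → x + N C (2 + k) ≡ N C (1 + k) → y + N C (1 + k) ≡ N C k →
  (x + y) + suc N C (2 + k) ≡ suc N C (1 + k)
pascal-step N k {x} {y} eq₁ eq₂ = begin
  (x + y) + suc N C (2 + k)               ≡⟨ cong ((x + y) +_) (nCk+nC[k+1]≡[n+1]C[k+1] N (1 + k)) ⟨
  (x + y) + (N C (1 + k) + N C (2 + k))   ≡⟨ solve 4 (λ x y u v → (x :+ y) :+ (u :+ v) := (y :+ u) :+ (x :+ v))
                                               refl x y (N C (1 + k)) (N C (2 + k)) ⟩
  (y + N C (1 + k)) + (x + N C (2 + k))   ≡⟨ cong₂ _+_ eq₂ eq₁ ⟩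
  N C k + N C (1 + k)                     ≡⟨ nCk+nC[k+1]≡[n+1]C[k+1] N k ⟩
  suc N C (1 + k)                         ∎
  where
  open ≡-Reasoning
  open +-*-Solver

-- Symmetry of an odd row: the two middle coefficients agree, so the reflection formula gives 0 for
-- a closing at height zero.
central-C : ∀ p → (p + suc p) C suc p ≡ (p + suc p) C p
central-C p = trans (nCk≡nC[n∸k] (m≤n+m (suc p) p)) (cong ((p + suc p) C_) (m+n∸n≡m p (suc p)))

-- The reflection principle, with the subtraction moved to the other side.

length-ballots : ∀ p d →
  length (ballots p d) + (p + (p + d)) C suc (p + d) ≡ (p + (p + d)) C (p + d)
length-ballots zero    zero    = refl
length-ballots zero    (suc d) = begin
  length (map (d ∷_) (ballots zero d)) + suc d C (2 + d)   ≡⟨ cong (_+ suc d C (2 + d)) (length-map (d ∷_) (ballots zero d)) ⟩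
  -- No letter is left to open, so `x` is 0 and both coefficients in its hypothesis vanish.
  length (ballots zero d) + suc d C (2 + d)                ≡⟨ pascal-step d d
    (trans (k>n⇒nCk≡0 (m≤n⇒m≤1+n (n<1+n d))) (sym (k>n⇒nCk≡0 (n<1+n d)))) (length-ballots zero d) ⟩
  suc d C suc d                                            ∎
  where open ≡-Reasoning
length-ballots (suc p) zero    =
  subst (λ q → length (map (p ∷_) (ballots p 1)) + (suc p + suc q) C (2 + q) ≡ (suc p + suc q) C suc q)
    (sym (+-identityʳ p)) (begin
  length (map (p ∷_) (ballots p 1)) + C₂   ≡⟨ cong (_+ C₂) (length-map (p ∷_) (ballots p 1)) ⟩
  -- The inserted 0 counts the closings at height zero; its hypothesis is `central-C`.
  length (ballots p 1) + C₂                ≡⟨ cong (_+ C₂) (+-identityʳ (length (ballots p 1))) ⟨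
  length (ballots p 1) + 0 + C₂            ≡⟨ pascal-step (p + suc p) p
    (subst (λ q → length (ballots p 1) + (p + q) C suc q ≡ (p + q) C q) (+-comm p 1) (length-ballots p 1))
    (central-C p) ⟩
  (suc p + suc p) C suc p                  ∎)
  where
  open ≡-Reasoning
  C₂ = (suc p + suc p) C (2 + p)
length-ballots (suc p) (suc d) =
  subst (λ q → length (opens ++ closes) + (suc p + suc q) C (2 + q) ≡ (suc p + suc q) C suc q)
    (sym (+-suc p d)) (begin
  length (opens ++ closes) + C₂                              ≡⟨ cong (_+ C₂) (length-++ opens) ⟩
  length opens + length closes + C₂                          ≡⟨ cong (_+ C₂) (cong₂ _+_
    (length-map (p ∷_) (ballots p (2 + d))) (length-map (suc p + d ∷_) (ballots (suc p) d))) ⟩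
  length (ballots p (2 + d)) + length (ballots (suc p) d) + C₂   ≡⟨ pascal-step (p + suc m) m
    (subst (λ q → length (ballots p (2 + d)) + (p + q) C suc q ≡ (p + q) C q)
      (trans (+-suc p (suc d)) (cong suc (+-suc p d))) (length-ballots p (2 + d)))
    (subst (λ N → length (ballots (suc p) d) + N C suc m ≡ N C m)
      (sym (+-suc p m)) (length-ballots (suc p) d)) ⟩
  (suc p + suc m) C suc m                                    ∎)
  where
  open ≡-Reasoning
  m      = suc (p + d)
  opens  = map (p ∷_) (ballots p (2 + d))
  closes = map (suc p + d ∷_) (ballots (suc p) d)
  C₂     = (suc p + suc m) C (2 + m)

-- The absorption identity (k + 1) C(n, k + 1) = (n - k) C(n, k), with both sides moved so that no
-- subtraction occurs.

absorption : ∀ n k → suc k * (n C suc k) + k * (n C k) ≡ n * (n C k)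
absorption zero    zero    = refl
absorption zero    (suc k) = cong₂ _+_ (*-zeroʳ (2 + k)) (*-zeroʳ (1 + k))
absorption (suc n) zero    = begin
  1 * (suc n C 1) + 0   ≡⟨ +-identityʳ (1 * (suc n C 1)) ⟩
  1 * (suc n C 1)       ≡⟨ cong (1 *_) (nC1≡n (suc n)) ⟩
  1 * suc n             ≡⟨ *-comm 1 (suc n) ⟩
  suc n * (suc n C 0)   ∎
  where open ≡-Reasoning
absorption (suc n) (suc k) = begin
  (2 + k) * (suc n C (2 + k)) + (1 + k) * (suc n C (1 + k))
    ≡⟨ cong₂ (λ u v → (2 + k) * u + (1 + k) * v)
         (nCk+nC[k+1]≡[n+1]C[k+1] n (1 + k)) (nCk+nC[k+1]≡[n+1]C[k+1] n k) ⟨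
  (2 + k) * (c₁ + c₂) + (1 + k) * (c₀ + c₁)
    -- The regrouping exposes the identity for `n` at `1 + k` and at `k`; the surplus `c₀ + c₁`
    -- raises the factor `n` to `suc n`.
    ≡⟨ solve 4 (λ k c₀ c₁ c₂ → (con 2 :+ k) :* (c₁ :+ c₂) :+ (con 1 :+ k) :* (c₀ :+ c₁)
         := (con 2 :+ k) :* c₂ :+ (con 1 :+ k) :* c₁ :+ ((con 1 :+ k) :* c₁ :+ k :* c₀) :+ (c₀ :+ c₁))
         refl k c₀ c₁ c₂ ⟩
  ((2 + k) * c₂ + (1 + k) * c₁) + ((1 + k) * c₁ + k * c₀) + (c₀ + c₁)
    ≡⟨ cong₂ (λ u v → u + v + (c₀ + c₁)) (absorption n (1 + k)) (absorption n k) ⟩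
  n * c₁ + n * c₀ + (c₀ + c₁)
    ≡⟨ solve 3 (λ n c₀ c₁ → n :* c₁ :+ n :* c₀ :+ (c₀ :+ c₁) := (con 1 :+ n) :* (c₀ :+ c₁)) refl n c₀ c₁ ⟩
  suc n * (c₀ + c₁)
    ≡⟨ cong (suc n *_) (nCk+nC[k+1]≡[n+1]C[k+1] n k) ⟩
  suc n * (suc n C suc k) ∎
  where
  open ≡-Reasoning
  open +-*-Solver
  c₀ = n C k
  c₁ = n C (1 + k)
  c₂ = n C (2 + k)

-- Reflection gives `L + c′ ≡ c` and absorption gives (n + 1) c′ = n c, whence (n + 1) L = c, the
-- equation that `catalan-exact` states for `catalan n`. To avoid subtraction, `2 * n * c` is added
-- to both sides and cancelled.
length-ballots-catalan : ∀ n → length (ballots n 0) ≡ catalan n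
length-ballots-catalan n = *-cancelˡ-≡ L (catalan n) (suc n) (trans
  (+-cancelʳ-≡ (2 * n * c) (suc n * L) c (begin
    suc n * L + 2 * n * c
      ≡⟨ cong (suc n * L +_) (absorption (2 * n) n) ⟨
    suc n * L + (suc n * c′ + n * c)
      ≡⟨ solve 4 (λ n L c c′ → (con 1 :+ n) :* L :+ ((con 1 :+ n) :* c′ :+ n :* c)
           := (con 1 :+ n) :* (L :+ c′) :+ n :* c) refl n L c c′ ⟩
    suc n * (L + c′) + n * c
      ≡⟨ cong (λ m → suc n * m + n * c) L+c′≡c ⟩
    suc n * c + n * c
      ≡⟨ solve 2 (λ n c → (con 1 :+ n) :* c :+ n :* c := c :+ con 2 :* n :* c) refl n c ⟩
    c + 2 * n * c ∎))
  (sym (catalan-exact n)))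
  where
  open ≡-Reasoning
  open +-*-Solver
  L  = length (ballots n 0)
  c  = (2 * n) C n
  c′ = (2 * n) C suc n
  L+c′≡c : L + c′ ≡ c
  L+c′≡c = subst (λ N → L + N C suc n ≡ N C n) (cong (n +_) (sym (+-identityʳ n)))
    (subst (λ q → L + (n + q) C suc q ≡ (n + q) C q) (+-identityʳ n) (length-ballots n 0))

theorem2 : ∀ (n : ℕ) → n ≥ 1 →
    s n 2 ((1 ∷ 1 ∷ 2 ∷ []) ∷ (1 ∷ 2 ∷ 2 ∷ []) ∷ []) ≡ catalan n
theorem2 n _ = trans (s≡length-ballots n) (length-ballots-catalan n)
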